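{- Let $(A,B,R)$ be a formal context whose concept lattice $\mathcal C(A,B,R)$ has no infinite chains, and let $C_l\in\mathcal C(A,B,R)$ be a meet-irreducible concept. Let $(A^*,B,R^*)$ be the context produced by Construction M below. Then $(\mathcal C(A,B,R)\setminus\{C_l\},\le)\cong(\mathcal C(A^*,B,R^*),\le^*)$. Construction M. Let $\mathcal S(C_l)=\{C\in\mathcal C(A,B,R)\mid C<C_l\}$ and $C_l^s=\bigvee\mathcal S(C_l)$ (the bottom if $\mathcal S(C_l)=\varnothing$). Put $A'=A\setminus\mathrm{Atg}(C_l)$. (1) If $C_l^s\neq C_l$: if there exists a meet-decomposition of $C_l^s$ not containing $C_l$, or $\mathrm{Atg}(C_l^s)\neq\varnothing$, then $A^*=A'$ and $R^*=R\cap(A^*\times B)$. Otherwise $A^*=A'\cup\{a^*\}$ for a new attribute $a^*\notin A$ and $R^*=(R\cap(A'\times B))\cup\{(a^*,b)\mid b\in\mathcal E(C_l^s)\}$. (2) If $C_l^s=C_l$: let $\{C_l^{s_i}\mid i\in\Gamma\}$ be the maximal elements of $\mathcal S(C_l)$ and $\Gamma'=\{i\in\Gamma\mid$ every meet-decomposition of $C_l^{s_i}$ contains $C_l$, and $\mathrm{Atg}(C_l^{s_i})=\varnothing\}$. If $\Gamma'=\varnothing$, then $A^*=A'$ and $R^*=R\cap(A^*\times B)$. Otherwise $A^*=A'\cup\{a_i^*\mid i\in\Gamma'\}$ with pairwise distinct new attributes and $R^*=(R\cap(A'\times B))\cup\{(a_i^*,b)\mid i\in\Gamma',\ b\in\mathcal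 E(C_l^{s_i})\}$.
   Context: Formal context $(A,B,R)$, $R\subseteq A\times B$; $X^{\uparrow}=\{a\in A\mid (a,x)\in R\ \forall x\in X\}$, $Y^{\downarrow}=\{x\in B\mid (a,x)\in R\ \forall a\in Y\}$; concepts are pairs $(X,Y)$ with $X^\uparrow=Y$, $Y^\downarrow=X$, ordered by inclusion of extents; $\mathcal E(C)$ denotes the extent of concept $C$. $\mathrm{Atg}(C)=\{a\in A\mid (\{a\}^{\downarrow},\{a\}^{\downarrow\uparrow})=C\}$ (attributes generating $C$). A concept is meet-irreducible if it is not the top and is not the meet of two concepts both different from it. A meet-decomposition of a concept $C$ is a set $\psi$ of concepts with $C\notin\psi$ and $\bigwedge\psi=C$. $\le^*$ is the extent-inclusion order on $\mathcal C(A^*,B,R^*)$. -}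

module Defs where

open import Axiom.ExcludedMiddle using (ExcludedMiddle)
open import Data.Bool.Base using (Bool; T)
open import Data.List.Base using (List)
open import Data.Product.Base using (Σ-syntax; ∃; ∃-syntax; _×_; _,_; proj₁; proj₂)
open import Data.Refinement.Base using (Refinement-syntax; value)
open import Data.Sum.Base using (_⊎_; inj₁; inj₂; [_,_])
open import Data.Unit.Polymorphic.Base using (⊤)
open import Function.Base using (_∘_; const)
open import Level using (Level; _⊔_; Lift; lift; lower) renaming (suc to lsuc)
open import Relation.Binary.Bundles using (Poset)
open import Relation.Binary.Core using (REL)
open import Relation.Binary.Definitions using (Maximum)
open import Relation.Binary.Morphism.Structures using (IsOrderIsomorphism)
open import Relation.Nullary.Decidable
  using (yes; no; True; toWitness; fromWitness; isYes)
open import Relation.Nullary.Negation using (¬_)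
open import Relation.Unary using (Pred; _∈_; _∉_; _⊆_; _≐_; _∪_; ｛_｝; Empty; Satisfiable; _⊢_)
import Data.List.Membership.Setoid as SetoidMembership
import Relation.Binary.Construct.On as On
import Relation.Binary.Properties.Poset as PosetProperties

private
  variable
    ℓ p c₁ c₂ c₃ d₁ d₂ d₃ : Level

------------------------------------------------------------------------
-- Orders.  Sets of elements are predicates; those for which membership
-- matters are required to respect the equality _≈_ of the poset.

module Order (P : Poset c₁ c₂ c₃) where
  open Poset P
  open PosetProperties P public using (_<_)
  open SetoidMembership Eq.setoid using () renaming (_∈_ to _∈ˡ_)

  IsInfimum : Pred Carrier p → Pred Carrier _
  IsInfimum ψ x = (∀ y → y ∈ ψ → x ≤ y) × (∀ z → (∀ y → y ∈ ψ → z ≤ y) → z ≤ x)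

  IsSupremum : Pred Carrier p → Pred Carrier _
  IsSupremum ψ x = (∀ y → y ∈ ψ → y ≤ x) × (∀ z → (∀ y → y ∈ ψ → y ≤ z) → x ≤ z)

  IsMaximalIn : Pred Carrier p → Pred Carrier _
  IsMaximalIn S x = x ∈ S × (∀ y → y ∈ S → ¬ (x < y))

  MeetIrreducible : Pred Carrier _
  MeetIrreducible x =
    ¬ Maximum _≤_ x ×
    ¬ (∃[ y ] ∃[ z ] ¬ y ≈ x × ¬ z ≈ x × IsInfimum (｛ y ｝ ∪ ｛ z ｝) x)

  record MeetDecomposition (x : Carrier) (ψ : Pred Carrier p) : Set (c₁ ⊔ c₂ ⊔ c₃ ⊔ p) where
    field
      respects  : ∀ {y z} → y ≈ z → y ∈ ψ → z ∈ ψ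
      avoids    : x ∉ ψ
      isInfimum : IsInfimum ψ x

  IsChain : Pred Carrier p → Set _
  IsChain K = ∀ x y → x ∈ K → y ∈ K → x ≤ y ⊎ y ≤ x

  Finite : Pred Carrier p → Set _
  Finite K = ∃[ xs ] (∀ x → x ∈ K → x ∈ˡ xs)

  NoInfiniteChains : (p : Level) → Set _
  NoInfiniteChains p = ¬ (Σ[ K ∈ Pred Carrier p ] IsChain K × ¬ Finite K)

infixl 6 _∖_
infix  4 _≅_

_∖_ : (P : Poset c₁ c₂ c₃) → Poset.Carrier P → Poset (c₁ ⊔ c₂) c₂ c₃
P ∖ x = On.poset {B = ∃[ y ] ¬ y ≈ x} P proj₁
  where open Poset P

_≅_ : Poset c₁ c₂ c₃ → Poset d₁ d₂ d₃ → Set _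
P ≅ Q = ∃ (IsOrderIsomorphism (Poset._≈_ P) (Poset._≈_ Q) (Poset._≤_ P) (Poset._≤_ Q))

------------------------------------------------------------------------
-- Formal contexts (A , B , R), with A the attributes and B the objects.

module _ {A B : Set ℓ} (R : REL A B ℓ) where

  up : Pred B ℓ → Pred A ℓ
  up X a = ∀ x → x ∈ X → R a x

  down : Pred A ℓ → Pred B ℓ
  down Y x = ∀ a → a ∈ Y → R a x

  record Concept : Set (lsuc ℓ) where
    field
      extent   : Pred B ℓ
      intent   : Pred A ℓ
      up≐      : up extent ≐ intent
      down≐    : down intent ≐ extent

  open Concept

  -- The intent is determined by the extent, so equality of extents is
  -- equality of concepts.
  conceptPoset : Poset (lsuc ℓ) ℓ ℓ
  conceptPoset = record
    { Carrier        = Concept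
    ; _≈_            = λ C D → extent C ≐ extent D
    ; _≤_            = λ C D → extent C ⊆ extent D
    ; isPartialOrder = record
      { isPreorder = record
        { isEquivalence = record
          { refl  = (λ x → x) , (λ x → x)
          ; sym   = λ (f , g) → g , f
          ; trans = λ (f , g) (h , k) → (λ x → h (f x)) , (λ x → g (k x))
          }
        ; reflexive = proj₁
        ; trans     = λ f g x → g (f x)
        }
      ; antisym = _,_
      }
    }

  attributeConcept : A → Concept
  attributeConcept a = record
    { extent = down ｛ a ｝
    ; intent = up (down ｛ a ｝)
    ; up≐    = (λ x → x) , (λ x → x)
    ; down≐  = (λ h a′ a≡a′ → h a′ λ y y∈ → y∈ a′ a≡a′) , (λ x∈ _ h → h _ x∈)
    }

  open Poset conceptPoset using (_≈_)
  open Order conceptPoset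

  Atg : Concept → Pred A ℓ
  Atg C a = attributeConcept a ≈ C

  module _ (Cₗ : Concept) where

    -- S(Cₗ)
    StrictlyBelow : Pred Concept ℓ
    StrictlyBelow C = C < Cₗ

    A′ : Set ℓ
    A′ = [ a ∈ A ∣ ¬ Atg Cₗ a ]

    R′ : REL A′ B ℓ
    R′ a b = R (value a) b

    Condition₁ : Pred Concept (lsuc ℓ)
    Condition₁ C = (Σ[ ψ ∈ Pred Concept ℓ ] MeetDecomposition C ψ × Cₗ ∉ ψ)
                 ⊎ Satisfiable (Atg C)

    -- The condition defining Γ′.
    Condition₂ : Pred Concept (lsuc ℓ)
    Condition₂ C = ((ψ : Pred Concept ℓ) → MeetDecomposition C ψ → Cₗ ∈ ψ)
                 × Empty (Atg C)

    -- The maximal elements of S(Cₗ) are { s i ∣ i ∈ Γ }.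
    record IndexesMaximal {Γ : Set ℓ} (s : Γ → Concept) : Set (lsuc ℓ) where
      field
        isMaximal : ∀ i → IsMaximalIn StrictlyBelow (s i)
        covers    : ∀ C → IsMaximalIn StrictlyBelow C → ∃[ i ] s i ≈ C

    -- ConstructionM A* R* says that (A* , B , R*) is produced by the
    -- construction.  Cˢ is ⋁ S(Cₗ), which is the bottom when S(Cₗ) is empty.
    -- Adjoining new, pairwise distinct attributes to A′ is a disjoint sum.
    -- Γ′ is given as a level-ℓ predicate equivalent to Condition₂ on Γ only
    -- in order to keep A* in Set ℓ.
    data ConstructionM : (A* : Set ℓ) → REL A* B ℓ → Set (lsuc ℓ) where

      case₁-restrict : ∀ Cˢ → IsSupremum StrictlyBelow Cˢ →
        ¬ Cˢ ≈ Cₗ → Condition₁ Cˢ →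
        ConstructionM A′ R′

      case₁-adjoin : ∀ Cˢ → IsSupremum StrictlyBelow Cˢ →
        ¬ Cˢ ≈ Cₗ → ¬ Condition₁ Cˢ →
        ConstructionM (A′ ⊎ ⊤ {ℓ}) [ R′ , const (extent Cˢ) ]

      case₂-restrict : ∀ Cˢ → IsSupremum StrictlyBelow Cˢ →
        Cˢ ≈ Cₗ →
        {Γ : Set ℓ} (s : Γ → Concept) → IndexesMaximal s →
        (Γ′ : Pred Γ ℓ) → Γ′ ≐ (s ⊢ Condition₂) → Empty Γ′ →
        ConstructionM A′ R′

      case₂-adjoin : ∀ Cˢ → IsSupremum StrictlyBelow Cˢ →
        Cˢ ≈ Cₗ →
        {Γ : Set ℓ} (s : Γ → Concept) → IndexesMaximal s →
        (Γ′ : Pred Γ ℓ) → Γ′ ≐ (s ⊢ Condition₂) → ¬ Empty Γ′ →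
        ConstructionM (A′ ⊎ [ i ∈ Γ ∣ Γ′ i ]) [ R′ , (λ i → extent (s (value i))) ]

------------------------------------------------------------------------
-- Classically the construction always produces a context, so that
-- quantifying over the contexts it produces is never vacuous.

module _ (em : ∀ {p} → ExcludedMiddle p) {A B : Set ℓ} (R : REL A B ℓ) where
  open Concept
  open Poset (conceptPoset R) using (_≈_)
  open Order (conceptPoset R)

  private
    Small : ∀ {p} → Set p → Set ℓ
    Small P = Lift ℓ (True (em {P = P}))

    small⁺ : ∀ {p} {P : Set p} → P → Small P
    small⁺ x = lift (fromWitness x)

    small⁻ : ∀ {p} {P : Set p} → Small P → P
    small⁻ x = toWitness (lower x)

  supremum-exists : (S : Pred (Concept R) p) → ∃ (IsSupremum S)
  supremum-exists S = ⋁S , upper , least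
    where
    Y : Pred A ℓ
    Y a = Small (∀ C → C ∈ S → a ∈ intent C)

    ⋁S : Concept R
    ⋁S = record
      { extent = down R Y
      ; intent = Y
      ; up≐    = (λ h → small⁺ λ C C∈S → proj₁ (up≐ C) λ x x∈C →
                   h x λ a a∈Y → proj₂ (up≐ C) (small⁻ a∈Y C C∈S) x x∈C)
               , (λ a∈Y x x∈ → x∈ _ a∈Y)
      ; down≐  = (λ x → x) , (λ x → x)
      }

    upper : ∀ C → C ∈ S → extent C ⊆ extent ⋁S
    upper C C∈S x∈C a a∈Y = proj₂ (up≐ C) (small⁻ a∈Y C C∈S) _ x∈C

    least : ∀ D → (∀ C → C ∈ S → extent C ⊆ extent D) → extent ⋁S ⊆ extent D
    least D ub x∈ = proj₁ (down≐ D) λ a a∈D → x∈ a (small⁺ λ C C∈S →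
      proj₁ (up≐ C) λ y y∈C → proj₂ (up≐ D) a∈D y (ub C C∈S y∈C))

  module _ (Cₗ : Concept R) where

    private
      Names : (B → Bool) → Pred (Concept R) _
      Names f C = IsMaximalIn (StrictlyBelow R Cₗ) C × (T ∘ f) ≐ extent C

      Γ : Set ℓ
      Γ = Σ[ f ∈ (B → Bool) ] Small (∃ (Names f))

      s : Γ → Concept R
      s (_ , w) = proj₁ (small⁻ w)

      Γ′ : Pred Γ ℓ
      Γ′ i = Small (Condition₂ R Cₗ (s i))

      Γ′≐ : Γ′ ≐ (s ⊢ Condition₂ R Cₗ)
      Γ′≐ = small⁻ , small⁺

      indexes : IndexesMaximal R Cₗ s
      indexes = record
        { isMaximal = λ (_ , w) → proj₁ (proj₂ (small⁻ w))
        ; covers    = λ C max →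
            let f = λ b → isYes (em {P = extent C b})
                w = small⁺ {P = ∃ (Names f)} (C , max , toWitness , fromWitness)
                (_ , _ , to , from) = small⁻ {P = ∃ (Names f)} w
            in (f , w) , (λ x → toWitness (from x)) , (λ x → to (fromWitness x))
        }

    constructionM-exists : Σ[ A* ∈ Set ℓ ] ∃ (ConstructionM R Cₗ A*)
    constructionM-exists with supremum-exists (StrictlyBelow R Cₗ)
    ... | Cˢ , sup with em {P = Cˢ ≈ Cₗ}
    ...   | no neq with em {P = Condition₁ R Cₗ Cˢ}
    ...     | yes q = _ , _ , case₁-restrict Cˢ sup neq q
    ...     | no ¬q = _ , _ , case₁-adjoin Cˢ sup neq ¬q
    constructionM-exists | Cˢ , sup | yes eq with em {P = Empty Γ′}
    ...     | yes e = _ , _ , case₂-restrict Cˢ sup eq s indexes Γ′ Γ′≐ e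
    ...     | no ¬e = _ , _ , case₂-adjoin Cˢ sup eq s indexes Γ′ Γ′≐ ¬e

{-# OPTIONS --safe #-}
-- A concept is determined by its extent, and the extents of a context are the
-- intersections of its columns R a.  So it suffices that the extents of R* are
-- exactly the extents of R other than that of Cₗ.
--
-- Descending chains being finite, the concepts above Cₗ have a minimal element,
-- and by meet-irreducibility it is the least one, Cₗ⁺.  Every column of R* is an
-- extent of R other than Cₗ, so an intersection of columns of R* that contains
-- Cₗ contains Cₗ⁺: it is an extent of R, but not that of Cₗ.
--
-- Conversely, the only columns of R lost in R* are those equal to the extent of
-- Cₗ, so an extent D ≠ Cₗ can only be lost if D < Cₗ.  Then D ≤ M for some
-- maximal M < Cₗ, and D survives if M does, as the column of Cₗ may be replaced
-- by M.  A decomposition of M that avoids Cₗ consists of concepts not below Cₗ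
-- by maximality, so M survives if it has one; M also survives if it is generated
-- by an attribute, and otherwise its extent is adjoined as a column.
module Submission where

open import Defs
open import Axiom.ExcludedMiddle using (ExcludedMiddle)
open import Axiom.DoubleNegationElimination using (em⇒dne)
open import Data.Empty using (⊥-elim-irr)
open import Data.Fin.Base using (toℕ)
open import Data.Fin.Properties using (pigeonhole)
open import Data.Irrelevant using ([_])
open import Data.List.Base using (length)
import Data.List.Membership.Setoid.Properties as Membership
import Data.List.Relation.Unary.Any as Any
open import Data.Nat.Base as ℕ using (ℕ; suc; ≤′-refl; ≤′-step)
import Data.Nat.Properties as ℕ
open import Data.Product.Base using (Σ-syntax; ∃-syntax; _×_; _,_; proj₁; proj₂)
open import Data.Refinement.Base as Refinement using (value)
open import Data.Sum.Base using (_⊎_; inj₁; inj₂; swap)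
open import Function.Base using (id; _∘_)
open import Level using (Level)
open import Relation.Binary.Bundles using (Poset)
import Relation.Binary.Construct.Flip.Ord as Flip
open import Relation.Binary.Core using (REL)
open import Relation.Binary.Definitions using (tri<; tri≈; tri>)
open import Relation.Binary.PropositionalEquality.Core using (refl)
open import Relation.Nullary.Decidable using (Dec; yes; no)
open import Relation.Nullary.Negation using (¬_; contradiction)
open import Relation.Unary using (Pred; _∈_; _⊆_; _≐_; _∩_)
open import Relation.Unary.Polymorphic using (U)
open import Relation.Unary.Properties using (≐-sym; ≐-trans)

open Concept

private
  variable
    c₁ c₂ c₃ p ℓ : Level

-- Maximal elements in orders without infinite chains

module _ (P : Poset c₁ c₂ c₃) where
  open Poset P renaming (refl to ≤-refl; trans to ≤-trans)
  open Order P
  open import Relation.Binary.Properties.Poset P using (<-trans; <⇒≉)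

  noInfiniteChains-flip : NoInfiniteChains p → Order.NoInfiniteChains (Flip.poset P) p
  noInfiniteChains-flip nic (K , chain , ¬fin) =
    nic (K , (λ x y x∈K y∈K → swap (chain x y x∈K y∈K)) ,
         λ (xs , K⊆xs) → ¬fin (xs , λ x x∈K → Any.map Eq.sym (K⊆xs x x∈K)))

  noStrictlyIncreasing : NoInfiniteChains c₂ →
    (f : ℕ → Carrier) → ¬ (∀ n → f n < f (suc n))
  noStrictlyIncreasing nic f step = nic (K , chain , infinite)
    where
    K : Pred Carrier c₂
    K x = ∃[ n ] x ≈ f n

    increasing′ : ∀ {m n} → m ℕ.<′ n → f m < f n
    increasing′ ≤′-refl       = step _
    increasing′ (≤′-step m<n) = <-trans (increasing′ m<n) (step _)

    increasing : ∀ {m n} → m ℕ.< n → f m < f n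
    increasing m<n = increasing′ (ℕ.≤⇒≤′ m<n)

    chain : IsChain K
    chain x y (m , x≈fm) (n , y≈fn) with ℕ.<-cmp m n
    ... | tri< m<n _ _ = inj₁ (≤-trans (reflexive x≈fm)
            (≤-trans (proj₁ (increasing m<n)) (reflexive (Eq.sym y≈fn))))
    ... | tri≈ _ refl _ = inj₁ (reflexive (Eq.trans x≈fm (Eq.sym y≈fn)))
    ... | tri> _ _ n<m = inj₂ (≤-trans (reflexive y≈fn)
            (≤-trans (proj₁ (increasing n<m)) (reflexive (Eq.sym x≈fm))))

    infinite : ¬ Finite K
    infinite (xs , K⊆xs) =
      -- Among the first `length xs + 1` values of `f`, two occupy the same position of `xs` and
      -- hence are equal.
      let f∈xs n = K⊆xs (f n) (n , Eq.refl)
          i , j , i<j , eq = pigeonhole (ℕ.n<1+n (length xs)) (Any.index ∘ f∈xs ∘ toℕ)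
      in <⇒≉ (increasing i<j)
             (Membership.index-injective Eq.setoid (f∈xs (toℕ i)) (f∈xs (toℕ j)) eq)

  -- Otherwise every element of `S` above `x` has a strictly larger one in `S`, and iterating from
  -- `x` gives a strictly increasing sequence.
  maximal-above : (∀ {p} → ExcludedMiddle p) → NoInfiniteChains c₂ →
    (S : Pred Carrier p) → ∀ x → x ∈ S → ∃[ y ] x ≤ y × IsMaximalIn S y
  maximal-above em nic S x x∈S with em {P = ∃[ y ] x ≤ y × IsMaximalIn S y}
  ... | yes found = found
  ... | no ¬found = contradiction (proj₂ ∘ larger ∘ seq) (noStrictlyIncreasing nic (proj₁ ∘ seq))
    where
    Above : Set _
    Above = ∃[ y ] x ≤ y × y ∈ S

    larger : ((y , _) : Above) → Σ[ (z , _) ∈ Above ] y < z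
    larger (y , x≤y , y∈S) = em⇒dne em λ ¬larger → ¬found (y , x≤y , y∈S ,
      λ z z∈S y<z → ¬larger ((z , ≤-trans x≤y (proj₁ y<z) , z∈S) , y<z))

    seq : ℕ → Above
    seq 0       = x , ≤-refl , x∈S
    seq (suc n) = proj₁ (larger (seq n))

-- Extents as closed sets of objects

module _ {A B : Set ℓ} (R : REL A B ℓ) where

  column≐ : ∀ a → R a ≐ extent (attributeConcept R a)
  column≐ a = (λ { r _ refl → r }) , (λ h → h a refl)

  -- The converse inclusion always holds.
  Closed : Pred B ℓ → Set ℓ
  Closed X = down R (up R X) ⊆ X

  down-up-mono : ∀ {X Y} → X ⊆ Y → down R (up R X) ⊆ down R (up R Y)
  down-up-mono X⊆Y b∈ a h = b∈ a λ x x∈X → h x (X⊆Y x∈X)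

  extent-closed : ∀ C → Closed (extent C)
  extent-closed C b∈ = proj₁ (down≐ C) λ a a∈C → b∈ a (proj₂ (up≐ C) a∈C)

  closed-resp-≐ : ∀ {X Y} → X ≐ Y → Closed X → Closed Y
  closed-resp-≐ (X⊆Y , Y⊆X) cl b∈ = X⊆Y (cl (down-up-mono Y⊆X b∈))

  column-closed : ∀ a → Closed (R a)
  column-closed a b∈ = b∈ a λ _ → id

  closed⇒concept : ∀ {X} → Closed X → Concept R
  closed⇒concept {X} cl = record
    { extent = X
    ; intent = up R X
    ; up≐    = id , id
    ; down≐  = cl , λ x∈X a h → h _ x∈X
    }

  closure : Pred B ℓ → Concept R
  closure X = record
    { extent = down R (up R X)
    ; intent = up R X
    ; up≐    = (λ h x x∈X → h x λ a k → k x x∈X) , (λ h x x∈ → x∈ _ h)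
    ; down≐  = id , id
    }

  closure-extensive : ∀ X → X ⊆ extent (closure X)
  closure-extensive X x∈X a h = h _ x∈X

  closure-least : ∀ {X} C → X ⊆ extent C → extent (closure X) ⊆ extent C
  closure-least C X⊆C b∈ = extent-closed C (down-up-mono X⊆C b∈)

  meet : Concept R → Concept R → Concept R
  meet C D = closed⇒concept {extent C ∩ extent D} λ b∈ →
    extent-closed C (down-up-mono proj₁ b∈) , extent-closed D (down-up-mono proj₂ b∈)

module _ (em : ∀ {p} → ExcludedMiddle p) {A B : Set ℓ} (R : REL A B ℓ)
         (nic : Order.NoInfiniteChains (conceptPoset R) ℓ)
         (Cₗ : Concept R) (irr : Order.MeetIrreducible (conceptPoset R) Cₗ)
         where
  open Poset (conceptPoset R) using (_≈_; _≤_)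
  open Order (conceptPoset R)

  least-above : ∃[ M ] Cₗ < M × (∀ C → Cₗ < C → M ≤ C)
  least-above = M , Cₗ<M , least
    where
    top : Concept R
    top = closure R U

    Cₗ<top : Cₗ < top
    Cₗ<top = (λ {b} _ → closure-extensive R U _) ,
      λ (_ , top≤Cₗ) → proj₁ irr λ C {b} _ → top≤Cₗ (closure-extensive R U _)

    minimal = maximal-above (Flip.poset (conceptPoset R)) em
      (noInfiniteChains-flip (conceptPoset R) nic) (Cₗ <_) top Cₗ<top

    M : Concept R
    M = proj₁ minimal

    Cₗ<M : Cₗ < M
    Cₗ<M = proj₁ (proj₂ (proj₂ minimal))

    least : ∀ C → Cₗ < C → M ≤ C
    -- If `b` is in `M` but not in `C`, then `meet R M C` is strictly below `M`. It is also strictly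
    -- above `Cₗ`, as otherwise `Cₗ` would be the meet of `M` and `C`. This contradicts minimality
    -- of `M`.
    least C (Cₗ≤C , Cₗ≉C) {b} b∈M = em⇒dne em λ b∉C →
      proj₂ (proj₂ (proj₂ minimal)) (meet R M C)
        ( (λ x∈ → proj₁ Cₗ<M x∈ , Cₗ≤C x∈)
        , λ (_ , M∧C≤Cₗ) → proj₂ irr
            (M , C , (λ eq → proj₂ Cₗ<M (≐-sym eq)) , (λ eq → Cₗ≉C (≐-sym eq))
            , (λ { _ (inj₁ refl) → proj₁ Cₗ<M ; _ (inj₂ refl) → Cₗ≤C })
            , λ Z lower x∈ → M∧C≤Cₗ (lower M (inj₁ refl) x∈ , lower C (inj₂ refl) x∈)))
        (proj₁ , λ eq → b∉C (proj₂ (proj₂ eq b∈M)))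

  module _ {A* : Set ℓ} (R* : REL A* B ℓ) where

    -- The map keeps the extent of each concept, so order and equality are preserved and reflected
    -- by `id`.
    ∖-iso : (∀ C → ¬ C ≈ Cₗ → Closed R* (extent C)) →
            (∀ D → Closed R (extent D)) →
            (∀ (D : Concept R*) → ¬ extent D ≐ extent Cₗ) →
            conceptPoset R ∖ Cₗ ≅ conceptPoset R*
    ∖-iso closed* closed ≉Cₗ = to , record
      { isOrderMonomorphism = record
        { isOrderHomomorphism = record { cong = id ; mono = id }
        ; injective = id
        ; cancel    = id
        }
      ; surjective = λ D → (closed⇒concept R (closed D) , ≉Cₗ D) , id
      }
      where
      to : (∃[ C ] ¬ C ≈ Cₗ) → Concept R*
      to (C , C≉Cₗ) = closed⇒concept R* (closed* C C≉Cₗ)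

    -- Contexts keeping the columns outside `Atg R Cₗ`, all of whose columns are extents other than
    -- that of `Cₗ`

    module _
      (kept : (a : A′ R Cₗ) → ∃[ a* ] R (value a) ≐ R* a*)
      (columns : ∀ a* → ∃[ C ] ¬ C ≈ Cₗ × R* a* ≐ extent C)
      where

      closed-in-R : (D : Concept R*) → Closed R (extent D)
      closed-in-R D {b} b∈ = proj₁ (down≐ D) λ a a∈D →
        let C , _ , a⊆C , C⊆a = columns a
        in C⊆a (closure-least R C (λ x∈D → a⊆C (proj₂ (up≐ D) a∈D _ x∈D)) b∈)

      extent≉Cₗ : (D : Concept R*) → ¬ extent D ≐ extent Cₗ
      extent≉Cₗ D (D⊆Cₗ , Cₗ⊆D) =
        let M , (Cₗ≤M , Cₗ≉M) , least = least-above
        in Cₗ≉M (Cₗ≤M , λ b∈M → D⊆Cₗ (proj₁ (down≐ D) λ a a∈D →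
             let C , C≉Cₗ , a⊆C , C⊆a = columns a
                 Cₗ≤C = λ {x} x∈ → a⊆C (proj₂ (up≐ D) a∈D x (Cₗ⊆D x∈))
             in C⊆a (least C (Cₗ≤C , λ eq → C≉Cₗ (≐-sym eq)) b∈M)))

      -- An attribute of `C` is lost only if it generates `Cₗ`; then `C ≤ Cₗ`, and `below` supplies
      -- the inclusion. For `C` not below `Cₗ` the hypothesis is vacuous.
      closed-if : ∀ C → (C ≤ Cₗ → down R* (up R* (extent C)) ⊆ extent Cₗ) →
                  Closed R* (extent C)
      closed-if C below {b} b∈ = extent-closed R C λ a C⊆a → case a C⊆a em
        where
        case : ∀ a → up R (extent C) a → Dec (Atg R Cₗ a) → R a b
        case a C⊆a (yes (a≤Cₗ , Cₗ≤a)) =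
          proj₂ (column≐ R a) (Cₗ≤a (below (λ x∈C → a≤Cₗ (proj₁ (column≐ R a) (C⊆a _ x∈C))) b∈))
        case a C⊆a (no a∉Atg) =
          let a* , to , from = kept (Refinement._,_ a [ a∉Atg ])
          in from (b∈ a* λ x x∈C → to (C⊆a x x∈C))

      condition₁⇒closed : ∀ M → IsMaximalIn (StrictlyBelow R Cₗ) M →
                          Condition₁ R Cₗ M → Closed R* (extent M)
      condition₁⇒closed M (M<Cₗ , maximal) (inj₁ (ψ , dec , Cₗ∉ψ)) {b} b∈ =
        -- The infimum is tested against concepts of `R`, so the closure of `M` in `R*` is closed
        -- again in `R`.
        proj₂ isInfimum (closure R (down R* (up R* (extent M))))
          (λ E E∈ψ → closure-least R E λ x∈ →
            closed-if E (λ E≤Cₗ → contradiction (M<E E E∈ψ) (maximal E (E<Cₗ E E∈ψ E≤Cₗ)))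
              (down-up-mono R* (proj₁ isInfimum E E∈ψ) x∈))
          (closure-extensive R _ b∈)
        where
        open MeetDecomposition dec

        M<E : ∀ E → E ∈ ψ → M < E
        M<E E E∈ψ = proj₁ isInfimum E E∈ψ , λ eq → avoids (respects (≐-sym eq) E∈ψ)

        E<Cₗ : ∀ E → E ∈ ψ → E ≤ Cₗ → E < Cₗ
        E<Cₗ E E∈ψ E≤Cₗ = E≤Cₗ , λ eq → Cₗ∉ψ (respects eq E∈ψ)
      condition₁⇒closed M ((_ , M≉Cₗ) , _) (inj₂ (a , a∈Atg)) =
        let a∉Atg = λ eq → M≉Cₗ (≐-trans (≐-sym a∈Atg) eq)
            a* , eq = kept (Refinement._,_ a [ a∉Atg ])
        in closed-resp-≐ R* (≐-trans (≐-sym eq) (≐-trans (column≐ R a) a∈Atg))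
                            (column-closed R* a*)

      -- The closure of `D` in `R*` lies in that of `M`, which is `M` itself and so lies in `Cₗ`, as
      -- `closed-if` requires.
      iso : (∀ D → D < Cₗ → ∃[ M ] D ≤ M × IsMaximalIn (StrictlyBelow R Cₗ) M ×
              (Condition₁ R Cₗ M ⊎ ∃[ a* ] R* a* ≐ extent M)) →
            conceptPoset R ∖ Cₗ ≅ conceptPoset R*
      iso survives = ∖-iso closed-in-R* closed-in-R extent≉Cₗ
        where
        closed-in-R* : ∀ D → ¬ D ≈ Cₗ → Closed R* (extent D)
        closed-in-R* D D≉Cₗ = closed-if D λ D≤Cₗ b∈ → case (survives D (D≤Cₗ , D≉Cₗ)) b∈
          where
          case : _ → down R* (up R* (extent D)) ⊆ extent Cₗ
          case (M , D≤M , max , inj₁ c) b∈ =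
            proj₁ (proj₁ max) (condition₁⇒closed M max c (down-up-mono R* D≤M b∈))
          case (M , D≤M , max , inj₂ (a* , eq)) b∈ =
            proj₁ (proj₁ max)
              (closed-resp-≐ R* eq (column-closed R* a*) (down-up-mono R* D≤M b∈))

  -- The cases of the construction

  A′-column : (a : A′ R Cₗ) → ∃[ C ] ¬ C ≈ Cₗ × R′ R Cₗ a ≐ extent C
  A′-column (Refinement._,_ a [ a∉Atg ]) =
    -- The proof `a∉Atg` is irrelevant, which still suffices to refute `a∈Atg`.
    attributeConcept R a , (λ a∈Atg → ⊥-elim-irr (a∉Atg a∈Atg)) , column≐ R a

  -- Brings the maximal concepts with index outside `Γ′` under `condition₁⇒closed`.
  ¬condition₂⇒condition₁ : ∀ C → ¬ Condition₂ R Cₗ C → Condition₁ R Cₗ C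
  ¬condition₂⇒condition₁ C ¬c₂ = em⇒dne em λ ¬c₁ → ¬c₂
    ( (λ ψ dec → em⇒dne em λ Cₗ∉ψ → ¬c₁ (inj₁ (ψ , dec , Cₗ∉ψ)))
    , λ a a∈Atg → ¬c₁ (inj₂ (a , a∈Atg)))

  -- In the first case the supremum thus serves as `M` for every `D < Cₗ`.
  supremum-maximal : ∀ Cˢ → IsSupremum (StrictlyBelow R Cₗ) Cˢ → ¬ Cˢ ≈ Cₗ →
                     IsMaximalIn (StrictlyBelow R Cₗ) Cˢ
  supremum-maximal Cˢ (upper , least) Cˢ≉Cₗ =
    (least Cₗ (λ _ → proj₁) , Cˢ≉Cₗ) ,
    λ D D<Cₗ (Cˢ≤D , Cˢ≉D) → Cˢ≉D (Cˢ≤D , upper D D<Cₗ)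

  indexed-above : {Γ : Set ℓ} (s : Γ → Concept R) → IndexesMaximal R Cₗ s →
                  ∀ D → D < Cₗ → ∃[ i ] D ≤ s i
  indexed-above s ix D D<Cₗ =
    let M , D≤M , max = maximal-above (conceptPoset R) em nic (StrictlyBelow R Cₗ) D D<Cₗ
        i , _ , M≤sᵢ = IndexesMaximal.covers ix M max
    in i , M≤sᵢ ∘ D≤M

  construction-iso : {A* : Set ℓ} (R* : REL A* B ℓ) → ConstructionM R Cₗ A* R* →
                     conceptPoset R ∖ Cₗ ≅ conceptPoset R*
  construction-iso R* (case₁-restrict Cˢ sup Cˢ≉Cₗ c₁) =
    iso R* (λ a → a , id , id) A′-column λ D D<Cₗ →
      Cˢ , proj₁ sup D D<Cₗ , supremum-maximal Cˢ sup Cˢ≉Cₗ , inj₁ c₁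
  construction-iso R* (case₁-adjoin Cˢ sup Cˢ≉Cₗ _) =
    iso R* (λ a → inj₁ a , id , id)
      (λ { (inj₁ a) → A′-column a ; (inj₂ _) → Cˢ , Cˢ≉Cₗ , id , id })
      λ D D<Cₗ → Cˢ , proj₁ sup D D<Cₗ , supremum-maximal Cˢ sup Cˢ≉Cₗ ,
        inj₂ (inj₂ _ , id , id)
  construction-iso R* (case₂-restrict _ _ _ s ix Γ′ (_ , condition₂⇒Γ′) empty) =
    iso R* (λ a → a , id , id) A′-column λ D D<Cₗ →
      let i , D≤sᵢ = indexed-above s ix D D<Cₗ
      in s i , D≤sᵢ , IndexesMaximal.isMaximal ix i ,
         inj₁ (¬condition₂⇒condition₁ (s i) (empty i ∘ condition₂⇒Γ′))
  construction-iso R* (case₂-adjoin _ _ _ s ix Γ′ (_ , condition₂⇒Γ′) _) =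
    iso R* (λ a → inj₁ a , id , id)
      (λ { (inj₁ a) → A′-column a
         ; (inj₂ i) → s (value i) , proj₂ (proj₁ (isMaximal (value i))) , id , id })
      λ D D<Cₗ →
        let i , D≤sᵢ = indexed-above s ix D D<Cₗ
        in s i , D≤sᵢ , isMaximal i , survives i em
    where
    open IndexesMaximal ix

    survives : ∀ i → Dec (Γ′ i) →
               Condition₁ R Cₗ (s i) ⊎ ∃[ a* ] R* a* ≐ extent (s i)
    survives i (yes i∈Γ′) = inj₂ (inj₂ (Refinement._,_ i [ i∈Γ′ ]) , id , id)
    survives i (no i∉Γ′)  = inj₁ (¬condition₂⇒condition₁ (s i) (i∉Γ′ ∘ condition₂⇒Γ′))

mainTheorem9 : (∀ {p} → ExcludedMiddle p) →
    ∀ {ℓ} {A B : Set ℓ} (R : REL A B ℓ) →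
    Order.NoInfiniteChains (conceptPoset R) ℓ →
    (Cₗ : Concept R) → Order.MeetIrreducible (conceptPoset R) Cₗ →
    ∀ {A* : Set ℓ} (R* : REL A* B ℓ) → ConstructionM R Cₗ A* R* →
    conceptPoset R ∖ Cₗ ≅ conceptPoset R*
mainTheorem9 em R nic Cₗ irr = construction-iso em R nic Cₗ irr
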